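{- Let $P$ be the ordered bipartite graph with $U(P)=\{a_1<a_2<a_3\}$, $V(P)=\{b_1<b_2<b_3<b_4\}$ and edge set $\{a_1b_1,a_1b_3,a_2b_1,a_2b_4,a_3b_2,a_3b_4\}$ (the "sailboat graph"). Then $$ex_2(n,P)=n\,2^{O(\sqrt{\log n\,\log\log n})}.$$
   Context: An ordered bipartite graph is a tuple $G=(U,<_U,V,<_V,E)$ with $U,V$ disjoint linearly ordered vertex sets and $E\subseteq U\times V$. $G$ contains an ordered bipartite graph $P$ if there are injective order-preserving maps $U(P)\to U(G)$ and $V(P)\to V(G)$ that send edges of $P$ to edges of $G$; otherwise $G$ avoids $P$. For $P$ with at least one edge, $ex_2(n,P)$ is the maximum number of edges of an ordered bipartite graph $G$ with $|U(G)|=|V(G)|=n$ avoiding $P$. Logarithms are base 2. -}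

module Defs where

open import Data.Nat using (ℕ; zero; suc; _+_; _*_; _^_; _≤_; _<_)
open import Data.Nat.Logarithm using (⌈log₂_⌉)
open import Data.Fin using (Fin; zero; suc) renaming (_<_ to _<ᶠ_)
open import Data.Bool using (Bool; true; false; if_then_else_)
open import Data.Product using (Σ; _×_)
open import Relation.Binary.PropositionalEquality using (_≡_)
open import Relation.Nullary using (¬_)

-- An ordered bipartite graph with |U| = p, |V| = q: the vertex sets are
-- Fin p and Fin q with their natural linear orders; E ⊆ U × V is given by
-- its (decidable) indicator function.
OBG : ℕ → ℕ → Set
OBG p q = Fin p → Fin q → Bool

∑ : (n : ℕ) → (Fin n → ℕ) → ℕ
∑ zero    f = 0
∑ (suc n) f = f zero + ∑ n (λ i → f (suc i))

edgeCount : ∀ {n m} → OBG n m → ℕ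
edgeCount {n} {m} G = ∑ n (λ i → ∑ m (λ j → if G i j then 1 else 0))

OrderEmb : ∀ {p n} → (Fin p → Fin n) → Set
OrderEmb {p} f = ∀ (i j : Fin p) → i <ᶠ j → f i <ᶠ f j

Contains : ∀ {n m p q} → OBG n m → OBG p q → Set
Contains {n} {m} {p} {q} G P =
  Σ (Fin p → Fin n) λ f → Σ (Fin q → Fin m) λ g →
    OrderEmb f × OrderEmb g ×
    (∀ (i : Fin p) (j : Fin q) → P i j ≡ true → G (f i) (g j) ≡ true)

Avoids : ∀ {n m p q} → OBG n m → OBG p q → Set
Avoids G P = ¬ Contains G P

ExAtMost : ∀ {p q} → OBG p q → ℕ → ℕ → Set
ExAtMost P n B = ∀ (G : OBG n n) → Avoids G P → edgeCount G ≤ B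

sailboat : OBG 3 4
sailboat zero                zero                      = true
sailboat zero                (suc (suc zero))          = true
sailboat (suc zero)          zero                      = true
sailboat (suc zero)          (suc (suc (suc zero)))    = true
sailboat (suc (suc zero))    (suc zero)                = true
sailboat (suc (suc zero))    (suc (suc (suc zero)))    = true
sailboat _                   _                         = false

-- integer stand-ins for log n and log log n
L : ℕ → ℕ
L n = ⌈log₂ n ⌉

LL : ℕ → ℕ
LL n = ⌈log₂ ⌈log₂ n ⌉ ⌉

{-# OPTIONS --safe #-}
module Submission where

-- Place the columns in dyadic intervals.  In a row, the elements of an interval
-- split into a left part X and a right part Y; passing to the heavier half at
-- each of the log n levels, it suffices to bound the sum of min(|X|, |Y|) over
-- the rows.  Cut X and Y at their medians.  Avoiding the sailboat forces, for
-- each row, one of two symmetric alternatives; say the low halves X′, Y′ are such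
-- that rows sharing an element of X′ have Y′ moving weakly leftwards as one goes
-- down.  Rows whose Y′ crosses a fixed boundary then have disjoint X′.  With
-- 2 ^ κ boundaries these rows have total weight at most 2 ^ κ times the interval
-- length, and all other rows have Y′ inside an interval shorter by the factor
-- 2 ^ κ.  So a factor O(log n) is lost while the length drops by 2 ^ κ, and after
-- log n / κ rounds the number of edges is at most n 2 ^ κ O(log n) ^ (log n / κ + 1);
-- now take κ of order √(log n log log n).

open import Defs
open import Data.Nat using (ℕ; _*_; _^_; _≤_)
open import Data.Product using (Σ)
open import Data.Nat using (zero; suc; _+_; _∸_; _<_; _⊓_; _⊔_; _/_; _%_; z≤n; s≤s; z<s; s<s; s≤s⁻¹; ⌊_/2⌋; ⌈_/2⌉; NonZero; >-nonZero; _≤?_; _<?_)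
open import Data.Nat.DivMod using (m≡m%n+[m/n]*n; m%n<n; m/n*n≤m; /-monoˡ-≤)
open import Data.Nat.Induction using (<-wellFounded)
open import Data.Nat.Logarithm using (⌈log₂_⌉; ⌈log₂⌉-mono-≤; ⌈log₂2^n⌉≡n)
open import Data.Nat.Logarithm.Core using (⌈log2⌉)
open import Data.Nat.Properties
open import Data.Nat.Tactic.RingSolver using (solve-∀)
open import Data.Bool using (Bool; true; false; if_then_else_; _∧_; not)
import Data.Bool as Bool
open import Data.Fin using (Fin; zero; suc; toℕ) renaming (_<_ to _<ᶠ_)
import Data.Fin as Fin
import Data.Fin.Properties as Fin
open import Data.Product using (_×_; _,_; proj₁; proj₂; ∃-syntax)
open import Data.Empty using (⊥; ⊥-elim)
open import Function using (_∘_)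
open import Induction.WellFounded using (Acc; acc)
open import Relation.Nullary using (¬_; Dec; yes; no; does; _×-dec_)
open import Relation.Binary.PropositionalEquality using (_≡_; refl; sym; trans; cong; cong₂; subst; subst₂; module ≡-Reasoning)

-- Boolean tests and finite sums over sets of rows.

∧-true : ∀ {b c} → b ∧ c ≡ true → b ≡ true × c ≡ true
∧-true {true} {true} _ = refl , refl

∧-intro : ∀ {b c} → b ≡ true → c ≡ true → b ∧ c ≡ true
∧-intro refl refl = refl

does-sound : ∀ {p} {P : Set p} (P? : Dec P) → does P? ≡ true → P
does-sound (yes p) _ = p

does-complete : ∀ {p} {P : Set p} (P? : Dec P) → P → does P? ≡ true
does-complete (yes _) _ = refl
does-complete (no ¬p) p = ⊥-elim (¬p p)

not-does-sound : ∀ {p} {P : Set p} (P? : Dec P) → not (does P?) ≡ true → ¬ P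
not-does-sound (no ¬p) _ = ¬p

∑-mono-≤ : ∀ {n} {f g : Fin n → ℕ} → (∀ i → f i ≤ g i) → ∑ n f ≤ ∑ n g
∑-mono-≤ {zero}  f≤g = z≤n
∑-mono-≤ {suc n} f≤g = +-mono-≤ (f≤g zero) (∑-mono-≤ (f≤g ∘ suc))

∑-cong : ∀ {n} {f g : Fin n → ℕ} → (∀ i → f i ≡ g i) → ∑ n f ≡ ∑ n g
∑-cong {zero}  f≡g = refl
∑-cong {suc n} f≡g = cong₂ _+_ (f≡g zero) (∑-cong (f≡g ∘ suc))

∑-zero : ∀ {n} {f : Fin n → ℕ} → (∀ i → f i ≡ 0) → ∑ n f ≡ 0
∑-zero {zero}  f≡0 = refl
∑-zero {suc n} f≡0 = cong₂ _+_ (f≡0 zero) (∑-zero (f≡0 ∘ suc))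

∑-one : ∀ n → ∑ n (λ _ → 1) ≡ n
∑-one zero    = refl
∑-one (suc n) = cong suc (∑-one n)

∑-+ : ∀ {n} (f g : Fin n → ℕ) → ∑ n (λ i → f i + g i) ≡ ∑ n f + ∑ n g
∑-+ {zero}  f g = refl
∑-+ {suc n} f g = begin
  f zero + g zero + ∑ n (λ i → f (suc i) + g (suc i))       ≡⟨ cong (f zero + g zero +_) (∑-+ (f ∘ suc) (g ∘ suc)) ⟩
  f zero + g zero + (∑ n (f ∘ suc) + ∑ n (g ∘ suc))         ≡⟨ interchange (f zero) (g zero) _ _ ⟩
  f zero + ∑ n (f ∘ suc) + (g zero + ∑ n (g ∘ suc))         ∎
  where
  open ≡-Reasoning
  interchange : ∀ a b c d → a + b + (c + d) ≡ a + c + (b + d)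
  interchange = solve-∀

_∩_ : ∀ {n} → (Fin n → Bool) → (Fin n → Bool) → Fin n → Bool
(A ∩ B) r = A r ∧ B r

sumOn : ∀ {n} → (Fin n → Bool) → (Fin n → ℕ) → ℕ
sumOn {n} A w = ∑ n (λ r → if A r then w r else 0)

card : ∀ {n} → (Fin n → Bool) → ℕ
card A = sumOn A (λ _ → 1)

module _ {n : ℕ} where

  sumOn-mono-≤ : ∀ (A : Fin n → Bool) {v w : Fin n → ℕ} →
                 (∀ r → A r ≡ true → v r ≤ w r) → sumOn A v ≤ sumOn A w
  sumOn-mono-≤ A {v} {w} v≤w = ∑-mono-≤ pointwise
    where
    pointwise : ∀ r → (if A r then v r else 0) ≤ (if A r then w r else 0)
    pointwise r with A r in eq
    ... | true  = v≤w r eq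
    ... | false = z≤n

  sumOn-+ : ∀ (A : Fin n → Bool) (v w : Fin n → ℕ) →
            sumOn A (λ r → v r + w r) ≡ sumOn A v + sumOn A w
  sumOn-+ A v w = trans (∑-cong pointwise) (∑-+ {n} _ _)
    where
    pointwise : ∀ r → (if A r then v r + w r else 0) ≡
                      (if A r then v r else 0) + (if A r then w r else 0)
    pointwise r with A r
    ... | true  = refl
    ... | false = refl

  sumOn-split : ∀ (A B : Fin n → Bool) (w : Fin n → ℕ) →
                sumOn A w ≡ sumOn (A ∩ B) w + sumOn (A ∩ (not ∘ B)) w
  sumOn-split A B w = trans (∑-cong pointwise) (∑-+ {n} _ _)
    where
    pointwise : ∀ r → (if A r then w r else 0) ≡
                      (if A r ∧ B r then w r else 0) + (if A r ∧ not (B r) then w r else 0)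
    pointwise r with A r | B r
    ... | true  | true  = sym (+-identityʳ (w r))
    ... | true  | false = refl
    ... | false | _     = refl

card-atMostOne : ∀ {n} (A : Fin n → Bool) →
                 (∀ r r′ → r <ᶠ r′ → A r ≡ true → A r′ ≡ true → ⊥) → card A ≤ 1
card-atMostOne {zero}  A excl = z≤n
card-atMostOne {suc n} A excl with A zero in eq
... | false = card-atMostOne (A ∘ suc) λ r r′ r<r′ → excl (suc r) (suc r′) (s<s r<r′)
... | true  = ≤-reflexive (cong suc (∑-zero rest))
  where
  rest : ∀ r → (if A (suc r) then 1 else 0) ≡ 0
  rest r with A (suc r) in eq′
  ... | true  = ⊥-elim (excl zero (suc r) z<s eq eq′)
  ... | false = refl

-- Counting a set of columns inside an interval of integers.

count : (ℕ → Bool) → ℕ → ℕ → ℕ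
count S a zero    = 0
count S a (suc l) = (if S a then 1 else 0) + count S (suc a) l

count-+ : ∀ S a k l → count S a (k + l) ≡ count S a k + count S (a + k) l
count-+ S a zero    l = cong (λ b → count S b l) (sym (+-identityʳ a))
count-+ S a (suc k) l = begin
  here + count S (suc a) (k + l)                        ≡⟨ cong (here +_) (count-+ S (suc a) k l) ⟩
  here + (count S (suc a) k + count S (suc a + k) l)    ≡⟨ sym (+-assoc here _ _) ⟩
  here + count S (suc a) k + count S (suc a + k) l      ≡⟨ cong (λ b → here + count S (suc a) k + count S b l) (sym (+-suc a k)) ⟩
  here + count S (suc a) k + count S (a + suc k) l      ∎
  where
  open ≡-Reasoning
  here = if S a then 1 else 0

count-double : ∀ S a g → count S a (2 ^ suc g) ≡ count S a (2 ^ g) + count S (a + 2 ^ g) (2 ^ g)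
count-double S a g rewrite +-identityʳ (2 ^ g) = count-+ S a (2 ^ g) (2 ^ g)

count-mono-≤ : ∀ {S S′} a l → (∀ x → a ≤ x → x < a + l → S x ≡ true → S′ x ≡ true) →
               count S a l ≤ count S′ a l
count-mono-≤ a zero S⊆S′ = z≤n
count-mono-≤ {S} {S′} a (suc l) S⊆S′ = +-mono-≤ here there
  where
  here : (if S a then 1 else 0) ≤ (if S′ a then 1 else 0)
  here with S a in eq
  ... | false = z≤n
  ... | true rewrite S⊆S′ a ≤-refl (m<m+n a z<s) eq = ≤-refl
  there : count S (suc a) l ≤ count S′ (suc a) l
  there = count-mono-≤ (suc a) l λ x a<x x<a+l →
    S⊆S′ x (<⇒≤ a<x) (subst (x <_) (sym (+-suc a l)) x<a+l)

count-shift : ∀ S a l → count S (suc a) l ≡ count (S ∘ suc) a l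
count-shift S a zero    = refl
count-shift S a (suc l) = cong ((if S (suc a) then 1 else 0) +_) (count-shift S (suc a) l)

count-witness : ∀ S a l → 0 < count S a l → ∃[ x ] (a ≤ x × x < a + l × S x ≡ true)
count-witness S a (suc l) pos with S a in eq
... | true  = a , ≤-refl , m<m+n a z<s , eq
... | false with count-witness S (suc a) l pos
...   | x , a<x , x<a+l , Sx = x , <⇒≤ a<x , subst (x <_) (sym (+-suc a l)) x<a+l , Sx

-- Double counting, column by column: each of the `l` columns lies in `X r` for at most one row `r`
-- of `A`, so it contributes at most 1 to the sum.
sumOn-count-disjoint : ∀ {n} (A : Fin n → Bool) (X : Fin n → ℕ → Bool) a l →
  (∀ r r′ x → r <ᶠ r′ → A r ≡ true → A r′ ≡ true → X r x ≡ true → X r′ x ≡ true → ⊥) →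
  sumOn A (λ r → count (X r) a l) ≤ l
sumOn-count-disjoint A X a zero disj = ≤-reflexive (∑-zero λ r → if-same (A r))
  where
  if-same : ∀ b → (if b then 0 else 0) ≡ 0
  if-same true  = refl
  if-same false = refl
sumOn-count-disjoint A X a (suc l) disj = begin
  sumOn A (λ r → here r + count (X r) (suc a) l)            ≡⟨ sumOn-+ A here _ ⟩
  sumOn A here + sumOn A (λ r → count (X r) (suc a) l)      ≤⟨ +-mono-≤ here≤1 (sumOn-count-disjoint A X (suc a) l disj) ⟩
  suc l                                                     ∎
  where
  open ≤-Reasoning
  here : ∀ r → ℕ
  here r = if X r a then 1 else 0
  A∩Xa = A ∩ (λ r → X r a)
  pointwise : ∀ r → (if A r then here r else 0) ≤ (if A∩Xa r then 1 else 0)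
  pointwise r with A r
  ... | true  = ≤-refl
  ... | false = z≤n
  here≤1 : sumOn A here ≤ 1
  here≤1 = ≤-trans (∑-mono-≤ pointwise) (card-atMostOne A∩Xa λ r r′ r<r′ p q →
    disj r r′ a r<r′ (proj₁ (∧-true p)) (proj₁ (∧-true q)) (proj₂ (∧-true {A r} p)) (proj₂ (∧-true {A r′} q)))

cutPoint : ∀ S a l u v → u + v ≤ count S a l → ∃[ p ] (a ≤ p × p ≤ a + l ×
  u ≤ count (λ x → S x ∧ does (x <? p)) a l × v ≤ count (λ x → S x ∧ does (p ≤? x)) a l)
-- The scan runs from the left and stops as soon as `u` elements have been passed; everything from
-- here on lies in the upper part.
cutPoint S a l zero v v≤ = a , ≤-refl , m≤m+n a l , z≤n ,
  ≤-trans v≤ (count-mono-≤ a l λ x a≤x _ Sx → ∧-intro Sx (does-complete (a ≤? x) a≤x))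
cutPoint S a (suc l) (suc u) v u+v≤ with S a in eq
... | false with cutPoint S (suc a) l (suc u) v u+v≤
...   | p , a<p , p≤a+l , lo , hi =
        p , <⇒≤ a<p , subst (p ≤_) (sym (+-suc a l)) p≤a+l , ≤-trans lo (m≤n+m _ _) , ≤-trans hi (m≤n+m _ _)
cutPoint S a (suc l) (suc u) v u+v≤ | true with cutPoint S (suc a) l u v (s≤s⁻¹ u+v≤)
... | p , a<p , p≤a+l , lo , hi =
        p , <⇒≤ a<p , subst (p ≤_) (sym (+-suc a l)) p≤a+l , lo′ , ≤-trans hi (m≤n+m _ _)
  where
  lo′ : suc u ≤ (if does (a <? p) then 1 else 0) + count (λ x → S x ∧ does (x <? p)) (suc a) l
  lo′ rewrite does-complete (a <? p) a<p = s≤s lo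

record Halves (S : ℕ → Bool) (a l w : ℕ) : Set where
  field
    low high  : ℕ → Bool
    low-size  : w ≤ count low a l
    high-size : w ≤ count high a l
    low⊆      : ∀ x → low x ≡ true → S x ≡ true × a ≤ x × x < a + l
    high⊆     : ∀ x → high x ≡ true → S x ≡ true × a ≤ x × x < a + l
    low<high  : ∀ x y → low x ≡ true → high y ≡ true → x < y

halves : ∀ S a l w → w + w ≤ count S a l → Halves S a l w
halves S a l w 2w≤ with cutPoint S a l w w 2w≤
... | p , a≤p , p≤a+l , lo , hi = record
  { low       = low
  ; high      = high
  ; low-size  = ≤-trans lo (count-mono-≤ a l λ x a≤x _ Sx → ∧-intro Sx (does-complete (a ≤? x) a≤x))
  ; high-size = ≤-trans hi (count-mono-≤ a l λ x _ x<a+l Sx → ∧-intro Sx (does-complete (x <? a + l) x<a+l))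
  ; low⊆      = λ x lx → let Sx<p , a≤x = ∧-true lx ; Sx , x<p = ∧-true Sx<p in
                Sx , does-sound (a ≤? x) a≤x , <-≤-trans (does-sound (x <? p) x<p) p≤a+l
  ; high⊆     = λ x hx → let Sx≥p , x< = ∧-true hx ; Sx , p≤x = ∧-true Sx≥p in
                Sx , ≤-trans a≤p (does-sound (p ≤? x) p≤x) , does-sound (x <? a + l) x<
  ; low<high  = λ x y lx hy → <-≤-trans
                (does-sound (x <? p) (proj₂ (∧-true {S x} (proj₁ (∧-true lx)))))
                (does-sound (p ≤? y) (proj₂ (∧-true {S y} (proj₁ (∧-true hy)))))
  }
  where
  -- Only the outer end of the interval is tested on each side; the inner end follows from `a ≤ p`
  -- and `p ≤ a + l`.
  low high : ℕ → Bool
  low  x = (S x ∧ does (x <? p)) ∧ does (a ≤? x)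
  high x = (S x ∧ does (p ≤? x)) ∧ does (x <? a + l)

-- Sailboat-free families of rows and the bound carried through the induction.

SailboatFree : ∀ {n} → (Fin n → ℕ → Bool) → Set
SailboatFree G = ∀ {r₁ r₂ r₃ c₁ c₂ c₃ c₄} →
  r₁ <ᶠ r₂ → r₂ <ᶠ r₃ → c₁ < c₂ → c₂ < c₃ → c₃ < c₄ →
  G r₁ c₁ ≡ true → G r₁ c₃ ≡ true →
  G r₂ c₁ ≡ true → G r₂ c₄ ≡ true →
  G r₃ c₂ ≡ true → G r₃ c₄ ≡ true → ⊥

-- The bound is a charge of `B` per row and `B * K` per column. It is demanded for every row set and
-- every starting point because the recursion restricts both, and its linear form lets the bounds
-- for disjoint row sets on the two halves of an interval add up.
Bounded : ∀ {n} → (Fin n → ℕ → Bool) → (B K g : ℕ) → Set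
Bounded {n} G B K g = ∀ (A : Fin n → Bool) a →
  sumOn A (λ r → count (G r) a (2 ^ g)) ≤ B * (card A + K * 2 ^ g)

-- Rows that move monotonically through an interval.

module _ {n : ℕ} (G : Fin n → ℕ → Bool) where

  module _ {B K d : ℕ} (bounded : ∀ {g} → g ≤ d → Bounded G B K g)
           (X Y : Fin n → ℕ → Bool) (b l : ℕ) (w : Fin n → ℕ)
           (Y⊆G : ∀ r y → Y r y ≡ true → G r y ≡ true) where

    open ≤-Reasoning

    -- The end of the recursion: the interval is now short enough for `bounded`, and the spare `l`
    -- fits into `2 ^ k * l`.
    concentrate-short : ∀ k {g} → g ≤ d → (A : Fin n → Bool) (a : ℕ) →
      (∀ r → A r ≡ true → w r ≤ count (Y r) a (2 ^ g)) →
      sumOn A w + l ≤ 2 ^ k * l + B * (card A + K * 2 ^ g)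
    concentrate-short k {g} g≤d A a w≤Y = begin
      sumOn A w + l                                     ≡⟨ +-comm (sumOn A w) l ⟩
      l + sumOn A w                                     ≤⟨ +-mono-≤ (m≤n*m l (2 ^ k) ⦃ m^n≢0 2 k ⦄) (sumOn-mono-≤ A w≤G) ⟩
      2 ^ k * l + sumOn A (λ r → count (G r) a (2 ^ g)) ≤⟨ +-monoʳ-≤ (2 ^ k * l) (bounded g≤d A a) ⟩
      2 ^ k * l + B * (card A + K * 2 ^ g)              ∎
      where
      w≤G : ∀ r → A r ≡ true → w r ≤ count (G r) a (2 ^ g)
      w≤G r Ar = ≤-trans (w≤Y r Ar) (count-mono-≤ a (2 ^ g) λ x _ _ → Y⊆G r x)

    -- Rows of A that hit both halves of an interval are disjoint inside X, so
    -- they weigh at most l; every other row descends to one half.  After k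
    -- halvings the length is at most 2 ^ d.
    concentrate : ∀ k {g} → g ≤ k + d → (A : Fin n → Bool) (a : ℕ) →
      (∀ r → A r ≡ true → w r ≤ count (X r) b l) →
      (∀ r → A r ≡ true → w r ≤ count (Y r) a (2 ^ g)) →
      (∀ r r′ x y y′ → r <ᶠ r′ → A r ≡ true → A r′ ≡ true →
         X r x ≡ true → X r′ x ≡ true → Y r y ≡ true → Y r′ y′ ≡ true → ¬ (y < y′)) →
      sumOn A w + l ≤ 2 ^ k * l + B * (card A + K * 2 ^ g)
    concentrate zero            g≤   A a w≤X w≤Y noCross = concentrate-short zero g≤ A a w≤Y
    -- A single column cannot be halved, but `0 ≤ d` already puts it within reach of `bounded`.
    concentrate (suc k) {zero}  g≤ A a w≤X w≤Y noCross = concentrate-short (suc k) z≤n A a w≤Y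
    concentrate (suc k) {suc g} g≤ A a w≤X w≤Y noCross = begin
      sumOn A w + l                                        ≡⟨ cong (_+ l) (splitA w) ⟩
      sumOn Ac w + sumOn Al w + sumOn Ar w + l             ≤⟨ +-monoˡ-≤ l (+-monoˡ-≤ (sumOn Ar w) (+-monoˡ-≤ (sumOn Al w) cross≤)) ⟩
      l + sumOn Al w + sumOn Ar w + l                      ≡⟨ regroup l (sumOn Al w) (sumOn Ar w) ⟩
      -- This is why `l` is added on the left of the claim: one copy is the cost of the crossing
      -- rows, the other is the claim's own, and each recursive call absorbs one.
      (sumOn Al w + l) + (sumOn Ar w + l)                  ≤⟨ +-mono-≤ left≤ right≤ ⟩
      (2 ^ k * l + B * (card Al + K * 2 ^ g)) + (2 ^ k * l + B * (card Ar + K * 2 ^ g))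
                                                           ≡⟨ collect (2 ^ k) l B (card Al) (card Ar) K (2 ^ g) ⟩
      2 ^ suc k * l + B * ((card Al + card Ar) + K * 2 ^ suc g)
                                                           ≤⟨ +-monoʳ-≤ (2 ^ suc k * l) (*-monoʳ-≤ B (+-monoˡ-≤ (K * 2 ^ suc g) cards≤)) ⟩
      2 ^ suc k * l + B * (card A + K * 2 ^ suc g)         ∎
      where
      m = a + 2 ^ g
      left? : ∀ r → Dec (0 < count (Y r) a (2 ^ g))
      left? r = 0 <? count (Y r) a (2 ^ g)
      right? : ∀ r → Dec (0 < count (Y r) m (2 ^ g))
      right? r = 0 <? count (Y r) m (2 ^ g)
      hitsL = λ r → does (left? r)
      hitsR = λ r → does (right? r)
      Ac = (A ∩ hitsL) ∩ hitsR
      Al = (A ∩ hitsL) ∩ (not ∘ hitsR)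
      -- Rows that miss both halves also land here; their weight is 0.
      Ar = A ∩ (not ∘ hitsL)

      splitA : ∀ v → sumOn A v ≡ sumOn Ac v + sumOn Al v + sumOn Ar v
      splitA v = trans (sumOn-split A hitsL v) (cong (_+ sumOn Ar v) (sumOn-split (A ∩ hitsL) hitsR v))

      cards≤ : card Al + card Ar ≤ card A
      cards≤ = begin
        card Al + card Ar           ≤⟨ m≤n+m _ (card Ac) ⟩
        card Ac + (card Al + card Ar) ≡⟨ sym (+-assoc (card Ac) _ _) ⟩
        card Ac + card Al + card Ar ≡⟨ sym (splitA _) ⟩
        card A                      ∎

      regroup : ∀ l s t → l + s + t + l ≡ (s + l) + (t + l)
      regroup = solve-∀
      collect : ∀ p l B s t K q →
        (p * l + B * (s + K * q)) + (p * l + B * (t + K * q)) ≡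
        (p + (p + 0)) * l + B * ((s + t) + K * (q + (q + 0)))
      collect = solve-∀

      Ac⊆ : ∀ r → Ac r ≡ true → A r ≡ true × 0 < count (Y r) a (2 ^ g) × 0 < count (Y r) m (2 ^ g)
      Ac⊆ r p = let q , hr = ∧-true p ; Ar′ , hl = ∧-true q in
        Ar′ , does-sound (left? r) hl , does-sound (right? r) hr

      -- The earlier row supplies an element left of `m` and the later one an element at or right of
      -- `m`, so a common `x` would contradict `noCross`.
      disjoint : ∀ r r′ x → r <ᶠ r′ → Ac r ≡ true → Ac r′ ≡ true → X r x ≡ true → X r′ x ≡ true → ⊥
      disjoint r r′ x r<r′ p p′ Xx X′x =
        let A₁ , hl , _ = Ac⊆ r p ; A₂ , _ , hr = Ac⊆ r′ p′
            y  , _ , y<m , Yy = count-witness (Y r) a (2 ^ g) hl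
            y′ , m≤y′ , _ , Yy′ = count-witness (Y r′) m (2 ^ g) hr
        in noCross r r′ x y y′ r<r′ A₁ A₂ Xx X′x Yy Yy′ (<-≤-trans y<m m≤y′)

      cross≤ : sumOn Ac w ≤ l
      cross≤ = ≤-trans (sumOn-mono-≤ Ac λ r p → w≤X r (proj₁ (Ac⊆ r p)))
                       (sumOn-count-disjoint Ac X b l disjoint)

      Al⊆ : ∀ r → Al r ≡ true → A r ≡ true
      Al⊆ r p = proj₁ (∧-true (proj₁ (∧-true p)))
      Ar⊆ : ∀ r → Ar r ≡ true → A r ≡ true
      Ar⊆ r p = proj₁ (∧-true p)

      left≤ : sumOn Al w + l ≤ 2 ^ k * l + B * (card Al + K * 2 ^ g)
      left≤ = concentrate k (s≤s⁻¹ g≤) Al a (λ r p → w≤X r (Al⊆ r p)) w≤left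
        (λ r r′ x y y′ r<r′ p p′ → noCross r r′ x y y′ r<r′ (Al⊆ r p) (Al⊆ r′ p′))
        where
        w≤left : ∀ r → Al r ≡ true → w r ≤ count (Y r) a (2 ^ g)
        w≤left r p = begin
          w r                                              ≤⟨ w≤Y r (Al⊆ r p) ⟩
          count (Y r) a (2 ^ suc g)                        ≡⟨ count-double (Y r) a g ⟩
          count (Y r) a (2 ^ g) + count (Y r) m (2 ^ g)    ≡⟨ cong (count (Y r) a (2 ^ g) +_) (n≤0⇒n≡0 (≮⇒≥ (not-does-sound (right? r) (proj₂ (∧-true {(A ∩ hitsL) r} p))))) ⟩
          count (Y r) a (2 ^ g) + 0                        ≡⟨ +-identityʳ _ ⟩
          count (Y r) a (2 ^ g)                            ∎

      right≤ : sumOn Ar w + l ≤ 2 ^ k * l + B * (card Ar + K * 2 ^ g)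
      right≤ = concentrate k (s≤s⁻¹ g≤) Ar m (λ r p → w≤X r (Ar⊆ r p)) w≤right
        (λ r r′ x y y′ r<r′ p p′ → noCross r r′ x y y′ r<r′ (Ar⊆ r p) (Ar⊆ r′ p′))
        where
        w≤right : ∀ r → Ar r ≡ true → w r ≤ count (Y r) m (2 ^ g)
        w≤right r p = begin
          w r                                              ≤⟨ w≤Y r (Ar⊆ r p) ⟩
          count (Y r) a (2 ^ suc g)                        ≡⟨ count-double (Y r) a g ⟩
          count (Y r) a (2 ^ g) + count (Y r) m (2 ^ g)    ≡⟨ cong (_+ count (Y r) m (2 ^ g)) (n≤0⇒n≡0 (≮⇒≥ (not-does-sound (left? r) (proj₂ (∧-true {A r} p))))) ⟩
          count (Y r) m (2 ^ g)                            ∎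

  Bounded-zero : ∀ {B K} → 1 ≤ B → Bounded G B K 0
  Bounded-zero {B} {K} 1≤B A a = begin
    sumOn A (λ r → count (G r) a 1)    ≤⟨ sumOn-mono-≤ A (λ r _ → count≤1 (G r a)) ⟩
    card A                             ≤⟨ m≤m+n (card A) (K * 1) ⟩
    card A + K * 1                     ≤⟨ m≤n*m (card A + K * 1) B ⦃ >-nonZero 1≤B ⦄ ⟩
    B * (card A + K * 1)               ∎
    where
    open ≤-Reasoning
    count≤1 : ∀ b → (if b then 1 else 0) + 0 ≤ 1
    count≤1 true  = ≤-refl
    count≤1 false = z≤n

  -- One round: from interval length `2 ^ d` to `2 ^ (κ + d)`.

  module _ (free : SailboatFree G) {B κ d : ℕ} (1≤B : 1 ≤ B)
           (bounded : ∀ {g} → g ≤ d → Bounded G B (2 ^ κ) g) where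

    -- A row is Seen if an earlier row shares one of its low x and has some
    -- right element y′ below one of its low y.  Then a later row sharing a
    -- high y cannot have a left element beyond a high x, as this would complete
    -- a sailboat.  So unseen rows are monotone on their low halves, seen rows
    -- on their high halves.
    straddle : ∀ {g} → g ≤ κ + d → (A : Fin n → Bool) (a : ℕ) →
      sumOn A (λ r → count (G r) a (2 ^ g) ⊓ count (G r) (a + 2 ^ g) (2 ^ g)) ≤
      4 * B * (card A + 2 ^ κ * 2 ^ suc g)
    straddle {g} g≤ A a = begin
      sumOn A m                                       ≤⟨ sumOn-mono-≤ A (λ r _ → m≤1+2w r) ⟩
      sumOn A (λ r → 1 + (w r + w r))                 ≡⟨ trans (sumOn-+ A (λ _ → 1) (λ r → w r + w r)) (cong (card A +_) (sumOn-+ A w w)) ⟩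
      card A + (sumOn A w + sumOn A w)                ≤⟨ +-monoʳ-≤ (card A) (+-mono-≤ sum-w≤ sum-w≤) ⟩
      card A + ((2 * (K * q) + B * (card A + 2 * (K * q))) + (2 * (K * q) + B * (card A + 2 * (K * q))))
                                                      ≡⟨ expand (card A) B (K * q) ⟩
      1 * (card A + 4 * (K * q)) + B * (2 * card A + 4 * (K * q))
                                                      ≤⟨ +-monoˡ-≤ _ (*-monoˡ-≤ (card A + 4 * (K * q)) 1≤B) ⟩
      B * (card A + 4 * (K * q)) + B * (2 * card A + 4 * (K * q))
                                                      -- Slack that raises the row coefficient from
                                                      -- `3 * B` to `4 * B`, so that rows and
                                                      -- columns share one factor.
                                                      ≤⟨ m≤m+n _ (B * card A) ⟩
      B * (card A + 4 * (K * q)) + B * (2 * card A + 4 * (K * q)) + B * card A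
                                                      ≡⟨ recombine (card A) B K q ⟩
      4 * B * (card A + K * 2 ^ suc g)                ∎
      where
      open ≤-Reasoning
      K = 2 ^ κ
      q = 2 ^ g
      c = a + q
      e = c + q
      m w : Fin n → ℕ
      m r = count (G r) a q ⊓ count (G r) c q
      -- All four halves of a row have at least this size. Rounding down loses at most 1 per row,
      -- which the term `card A` pays for.
      w r = ⌊ m r /2⌋

      2w≤m : ∀ r → w r + w r ≤ m r
      2w≤m r = ≤-trans (+-monoʳ-≤ (w r) (⌊n/2⌋≤⌈n/2⌉ (m r))) (≤-reflexive (⌊n/2⌋+⌈n/2⌉≡n (m r)))
      m≤1+2w : ∀ r → m r ≤ 1 + (w r + w r)
      m≤1+2w r = half (m r)
        where
        half : ∀ k → k ≤ 1 + (⌊ k /2⌋ + ⌊ k /2⌋)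
        half zero          = z≤n
        half (suc zero)    = s≤s z≤n
        half (suc (suc k)) = s≤s (subst (suc k ≤_) (cong suc (sym (+-suc ⌊ k /2⌋ ⌊ k /2⌋))) (s≤s (half k)))

      left : ∀ r → Halves (G r) a q (w r)
      left r = halves (G r) a q (w r) (≤-trans (2w≤m r) (m⊓n≤m _ _))
      right : ∀ r → Halves (G r) c q (w r)
      right r = halves (G r) c q (w r) (≤-trans (2w≤m r) (m⊓n≤n _ _))
      module L r = Halves (left r)
      module R r = Halves (right r)

      Seen : Fin n → Set
      Seen r = ∃[ r′ ] (r′ <ᶠ r ×
        (∃[ x ] (x < c × L.low r x ≡ true × G r′ x ≡ true)) ×
        (∃[ y ] (y < e × R.low r y ≡ true ×
          ∃[ y′ ] (y′ < y × c ≤ y′ × G r′ y′ ≡ true))))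

      -- The bounds `x < c`, `y < e` and `y′ < y` make every search finite.
      seen? : ∀ r → Dec (Seen r)
      seen? r = Fin.any? λ r′ → (r′ Fin.<? r)
        ×-dec anyUpTo? (λ x → (L.low r x Bool.≟ true) ×-dec (G r′ x Bool.≟ true)) c
        ×-dec anyUpTo? (λ y → (R.low r y Bool.≟ true) ×-dec
                anyUpTo? (λ y′ → (c ≤? y′) ×-dec (G r′ y′ Bool.≟ true)) y) e

      seen : Fin n → Bool
      seen r = does (seen? r)
      A₁ = A ∩ (not ∘ seen)
      A₂ = A ∩ seen

      -- With `y < y′`, the row `r` itself would witness that `r′` is `Seen`.
      lowMonotone : ∀ r r′ x y y′ → r <ᶠ r′ → A₁ r ≡ true → A₁ r′ ≡ true →
        L.low r x ≡ true → L.low r′ x ≡ true → R.low r y ≡ true → R.low r′ y′ ≡ true → ¬ (y < y′)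
      lowMonotone r r′ x y y′ r<r′ _ p′ Lx L′x Ry R′y′ y<y′ =
        not-does-sound (seen? r′) (proj₂ (∧-true {A r′} p′))
          (r , r<r′ ,
           (x , proj₂ (proj₂ (L.low⊆ r x Lx)) , L′x , proj₁ (L.low⊆ r x Lx)) ,
           (y′ , proj₂ (proj₂ (R.low⊆ r′ y′ R′y′)) , R′y′ ,
            y , y<y′ , proj₁ (proj₂ (R.low⊆ r y Ry)) , proj₁ (R.low⊆ r y Ry)))

      highMonotone : ∀ r r′ y x x′ → r <ᶠ r′ → A₂ r ≡ true → A₂ r′ ≡ true →
        R.high r y ≡ true → R.high r′ y ≡ true → L.high r x ≡ true → L.high r′ x′ ≡ true → ¬ (x < x′)
      highMonotone r r′ y x x′ r<r′ p _ Ry R′y Lx L′x′ x<x′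
        with does-sound (seen? r) (proj₂ (∧-true {A r} p))
      ... | r₀ , r₀<r , (x₀ , _ , Lx₀ , Gx₀) , (y₀ , _ , Ry₀ , y₁ , y₁<y₀ , c≤y₁ , Gy₁) =
        -- The sailboat has rows `r₀`, `r`, `r′` and columns `x₀`, `x′`, `y₁`, `y`. The median cuts
        -- give `x₀ < x` and `y₀ < y`, and `c` separates `x′` from `y₁`.
        free r₀<r r<r′
          (<-trans (L.low<high r x₀ x Lx₀ Lx) x<x′)
          (<-≤-trans (proj₂ (proj₂ (L.high⊆ r′ x′ L′x′))) c≤y₁)
          (<-trans y₁<y₀ (R.low<high r y₀ y Ry₀ Ry))
          Gx₀ Gy₁ (proj₁ (L.low⊆ r x₀ Lx₀)) (proj₁ (R.high⊆ r y Ry))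
          (proj₁ (L.high⊆ r′ x′ L′x′)) (proj₁ (R.high⊆ r′ y R′y))

      low≤ : sumOn A₁ w + q ≤ K * q + B * (card A₁ + K * q)
      low≤ = concentrate {B} {2 ^ κ} {d} bounded L.low R.low a q w (λ r y p → proj₁ (R.low⊆ r y p))
        κ g≤ A₁ c (λ r _ → L.low-size r) (λ r _ → R.low-size r) lowMonotone

      -- The sides trade roles: disjointness now occurs among the right elements, while the left
      -- interval is halved.
      high≤ : sumOn A₂ w + q ≤ K * q + B * (card A₂ + K * q)
      high≤ = concentrate {B} {2 ^ κ} {d} bounded R.high L.high c q w (λ r x p → proj₁ (L.high⊆ r x p))
        κ g≤ A₂ a (λ r _ → R.high-size r) (λ r _ → L.high-size r) highMonotone

      sum-w≤ : sumOn A w ≤ 2 * (K * q) + B * (card A + 2 * (K * q))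
      sum-w≤ = begin
        sumOn A w                        ≡⟨ sumOn-split A seen w ⟩
        sumOn A₂ w + sumOn A₁ w          ≤⟨ +-mono-≤ (≤-trans (m≤m+n _ q) high≤) (≤-trans (m≤m+n _ q) low≤) ⟩
        (K * q + B * (card A₂ + K * q)) + (K * q + B * (card A₁ + K * q))
                                         ≡⟨ collect (K * q) B (card A₂) (card A₁) ⟩
        2 * (K * q) + B * ((card A₂ + card A₁) + 2 * (K * q))
                                         ≡⟨ cong (λ s → 2 * (K * q) + B * (s + 2 * (K * q))) (sym (sumOn-split A seen (λ _ → 1))) ⟩
        2 * (K * q) + B * (card A + 2 * (K * q)) ∎
        where
        collect : ∀ z B s t → (z + B * (s + z)) + (z + B * (t + z)) ≡ 2 * z + B * ((s + t) + 2 * z)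
        collect = solve-∀

      expand : ∀ s B z → s + ((2 * z + B * (s + 2 * z)) + (2 * z + B * (s + 2 * z))) ≡
                         1 * (s + 4 * z) + B * (2 * s + 4 * z)
      expand = solve-∀
      recombine : ∀ s B K q → B * (s + 4 * (K * q)) + B * (2 * s + 4 * (K * q)) + B * s ≡
                              4 * B * (s + K * (q + (q + 0)))
      recombine = solve-∀

    -- Each row pays `straddle` for its lighter half and descends only into its heavier one. The two
    -- recursive row sets therefore partition `A`, and each level adds just `4 * B` to the factor
    -- instead of multiplying it.
    ascend : ∀ g → g ≤ κ + d → Bounded G (suc g * (4 * B)) (2 ^ κ) g
    ascend zero g≤ = Bounded-zero {K = 2 ^ κ} (*-mono-≤ {1} {1} ≤-refl (*-mono-≤ {1} {4} (s≤s z≤n) 1≤B))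
    ascend (suc g) g≤ A a = begin
      sumOn A (λ r → count (G r) a (2 ^ suc g))
        ≤⟨ sumOn-mono-≤ A (λ r _ → ≤-reflexive (minmax r)) ⟩
      sumOn A (λ r → (lo r ⊓ hi r) + (lo r ⊔ hi r))
        ≡⟨ sumOn-+ A (λ r → lo r ⊓ hi r) (λ r → lo r ⊔ hi r) ⟩
      sumOn A (λ r → lo r ⊓ hi r) + sumOn A (λ r → lo r ⊔ hi r)
        ≡⟨ cong (sumOn A (λ r → lo r ⊓ hi r) +_) (sumOn-split A heavyL (λ r → lo r ⊔ hi r)) ⟩
      sumOn A (λ r → lo r ⊓ hi r) + (sumOn Al (λ r → lo r ⊔ hi r) + sumOn Ar (λ r → lo r ⊔ hi r))
        ≤⟨ +-mono-≤ (straddle g≤′ A a) (+-mono-≤ left≤ right≤) ⟩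
      4 * B * (card A + K * 2 ^ suc g) + (D * (card Al + K * 2 ^ g) + D * (card Ar + K * 2 ^ g))
        ≡⟨ cong (4 * B * (card A + K * 2 ^ suc g) +_) (collect D (card Al) (card Ar) K (2 ^ g)) ⟩
      4 * B * (card A + K * 2 ^ suc g) + D * ((card Al + card Ar) + K * 2 ^ suc g)
        ≡⟨ cong (λ s → 4 * B * (card A + K * 2 ^ suc g) + D * (s + K * 2 ^ suc g)) (sym (sumOn-split A heavyL (λ _ → 1))) ⟩
      4 * B * (card A + K * 2 ^ suc g) + D * (card A + K * 2 ^ suc g)
        ≡⟨ sym (*-distribʳ-+ (card A + K * 2 ^ suc g) (4 * B) D) ⟩
      suc (suc g) * (4 * B) * (card A + K * 2 ^ suc g) ∎
      where
      open ≤-Reasoning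
      K = 2 ^ κ
      D = suc g * (4 * B)
      g≤′ : g ≤ κ + d
      g≤′ = ≤-trans (n≤1+n g) g≤
      lo hi : Fin n → ℕ
      lo r = count (G r) a (2 ^ g)
      hi r = count (G r) (a + 2 ^ g) (2 ^ g)
      heavyL : Fin n → Bool
      heavyL r = does (hi r ≤? lo r)
      Al = A ∩ heavyL
      Ar = A ∩ (not ∘ heavyL)

      ⊓+⊔ : ∀ x y → x + y ≡ (x ⊓ y) + (x ⊔ y)
      ⊓+⊔ zero    y       = refl
      ⊓+⊔ (suc x) zero    = +-identityʳ (suc x)
      ⊓+⊔ (suc x) (suc y) = cong suc (trans (+-suc x y) (trans (cong suc (⊓+⊔ x y)) (sym (+-suc (x ⊓ y) (x ⊔ y)))))
      minmax : ∀ r → count (G r) a (2 ^ suc g) ≡ (lo r ⊓ hi r) + (lo r ⊔ hi r)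
      minmax r = trans (count-double (G r) a g) (⊓+⊔ (lo r) (hi r))

      left≤ : sumOn Al (λ r → lo r ⊔ hi r) ≤ D * (card Al + K * 2 ^ g)
      left≤ = ≤-trans (sumOn-mono-≤ Al λ r p → ≤-reflexive (m≥n⇒m⊔n≡m (does-sound (hi r ≤? lo r) (proj₂ (∧-true {A r} p)))))
                      (ascend g g≤′ Al a)
      right≤ : sumOn Ar (λ r → lo r ⊔ hi r) ≤ D * (card Ar + K * 2 ^ g)
      right≤ = ≤-trans (sumOn-mono-≤ Ar λ r p → ≤-reflexive (m≤n⇒m⊔n≡n (≰⇒≥ (not-does-sound (hi r ≤? lo r) (proj₂ (∧-true {A r} p))))))
                       (ascend g g≤′ Ar (a + 2 ^ g))

      collect : ∀ D s t K q → D * (s + K * q) + D * (t + K * q) ≡ D * ((s + t) + K * (q + (q + 0)))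
      collect = solve-∀

  -- Every round gains `κ` in the exponent of the length and multiplies the factor by at most
  -- `suc h * 4`; the fixed `h` above all `g` keeps this multiplier uniform.
  iterate : SailboatFree G → ∀ κ h j {g} → g ≤ h → g ≤ j * κ →
            Bounded G ((suc h * 4) ^ j) (2 ^ κ) g
  iterate free κ h zero {zero} g≤h g≤ = Bounded-zero {K = 2 ^ κ} ≤-refl
  iterate free κ h (suc j) {g} g≤h g≤ A a = begin
    sumOn A (λ r → count (G r) a (2 ^ g))             ≤⟨ ascend free 1≤B hyp g g≤d A a ⟩
    suc g * (4 * B) * (card A + 2 ^ κ * 2 ^ g)        ≤⟨ *-monoˡ-≤ _ (*-monoˡ-≤ (4 * B) (s≤s g≤h)) ⟩
    suc h * (4 * B) * (card A + 2 ^ κ * 2 ^ g)        ≡⟨ cong (_* (card A + 2 ^ κ * 2 ^ g)) (sym (*-assoc (suc h) 4 B)) ⟩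
    (suc h * 4) ^ suc j * (card A + 2 ^ κ * 2 ^ g)    ∎
    where
    open ≤-Reasoning
    B = (suc h * 4) ^ j
    1≤B : 1 ≤ B
    1≤B = m^n>0 (suc h * 4) j
    -- The cap at `h` carries the hypothesis `g ≤ h` into the recursive call.
    hyp : ∀ {g} → g ≤ h ⊓ (j * κ) → Bounded G B (2 ^ κ) g
    hyp g≤ = iterate free κ h j (≤-trans g≤ (m⊓n≤m _ _)) (≤-trans g≤ (m⊓n≤n h _))
    g≤d : g ≤ κ + (h ⊓ (j * κ))
    g≤d = subst (g ≤_) (sym (+-distribˡ-⊓ κ h (j * κ))) (⊓-glb (≤-trans g≤h (m≤n+m h κ)) g≤)

-- From finite graphs to rows as sets of integers, padded with empty columns.

extend : ∀ {n} → (Fin n → Bool) → ℕ → Bool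
extend {zero}  f c       = false
extend {suc n} f zero    = f zero
extend {suc n} f (suc c) = extend (f ∘ suc) c

extend-toℕ : ∀ {n} (f : Fin n → Bool) i → extend f (toℕ i) ≡ f i
extend-toℕ f zero    = refl
extend-toℕ f (suc i) = extend-toℕ (f ∘ suc) i

extend-inRange : ∀ {n} (f : Fin n → Bool) c → extend f c ≡ true → Σ (Fin n) λ i → toℕ i ≡ c
extend-inRange {suc n} f zero    _ = zero , refl
extend-inRange {suc n} f (suc c) p with extend-inRange (f ∘ suc) c p
... | i , refl = suc i , refl

count-extend : ∀ {n} (f : Fin n → Bool) → count (extend f) 0 n ≡ ∑ n (λ j → if f j then 1 else 0)
count-extend {zero}  f = refl
count-extend {suc n} f = cong ((if f zero then 1 else 0) +_)
  (trans (count-shift (extend f) 0 n) (count-extend (f ∘ suc)))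

-- Every column of the sailboat carries an edge, so none of the four can lie in the padding and all
-- of them come from vertices of `G`.
extend-sailboatFree : ∀ {n m} (G : OBG n m) → Avoids G sailboat → SailboatFree (λ r → extend (G r))
extend-sailboatFree {n} {m} G avoids {r₁} {r₂} {r₃} {c₁} {c₂} {c₃} {c₄}
  r₁<r₂ r₂<r₃ c₁<c₂ c₂<c₃ c₃<c₄ e₁₁ e₁₃ e₂₁ e₂₄ e₃₂ e₃₄
  with extend-inRange (G r₁) c₁ e₁₁ | extend-inRange (G r₃) c₂ e₃₂
     | extend-inRange (G r₁) c₃ e₁₃ | extend-inRange (G r₂) c₄ e₂₄
... | i₁ , refl | i₂ , refl | i₃ , refl | i₄ , refl = avoids (f , g , f-mono , g-mono , edges)
  where
  f : Fin 3 → Fin n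
  f zero             = r₁
  f (suc zero)       = r₂
  f (suc (suc zero)) = r₃
  g : Fin 4 → Fin m
  g zero                   = i₁
  g (suc zero)             = i₂
  g (suc (suc zero))       = i₃
  g (suc (suc (suc zero))) = i₄
  f-mono : OrderEmb f
  f-mono zero       (suc zero)       _ = r₁<r₂
  f-mono zero       (suc (suc zero)) _ = <-trans r₁<r₂ r₂<r₃
  f-mono (suc zero) (suc (suc zero)) _ = r₂<r₃
  f-mono (suc zero) (suc zero) (s<s ())
  f-mono (suc (suc zero)) (suc zero) (s<s ())
  f-mono (suc (suc zero)) (suc (suc zero)) (s<s (s<s ()))
  g-mono : OrderEmb g
  g-mono zero             (suc zero)             _ = c₁<c₂
  g-mono zero             (suc (suc zero))       _ = <-trans c₁<c₂ c₂<c₃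
  g-mono zero             (suc (suc (suc zero))) _ = <-trans c₁<c₂ (<-trans c₂<c₃ c₃<c₄)
  g-mono (suc zero)       (suc (suc zero))       _ = c₂<c₃
  g-mono (suc zero)       (suc (suc (suc zero))) _ = <-trans c₂<c₃ c₃<c₄
  g-mono (suc (suc zero)) (suc (suc (suc zero))) _ = c₃<c₄
  g-mono (suc zero) (suc zero) (s<s ())
  g-mono (suc (suc zero)) (suc zero) (s<s ())
  g-mono (suc (suc zero)) (suc (suc zero)) (s<s (s<s ()))
  g-mono (suc (suc (suc zero))) (suc zero) (s<s ())
  g-mono (suc (suc (suc zero))) (suc (suc zero)) (s<s (s<s ()))
  g-mono (suc (suc (suc zero))) (suc (suc (suc zero))) (s<s (s<s (s<s ())))
  edge : ∀ {r i} → extend (G r) (toℕ i) ≡ true → G r i ≡ true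
  edge {r} {i} p = trans (sym (extend-toℕ (G r) i)) p
  edges : ∀ i j → sailboat i j ≡ true → G (f i) (g j) ≡ true
  edges zero             zero                   _ = edge e₁₁
  edges zero             (suc (suc zero))       _ = edge e₁₃
  edges (suc zero)       zero                   _ = edge e₂₁
  edges (suc zero)       (suc (suc (suc zero))) _ = edge e₂₄
  edges (suc (suc zero)) (suc zero)             _ = edge e₃₂
  edges (suc (suc zero)) (suc (suc (suc zero))) _ = edge e₃₄
  edges zero             (suc zero)             ()
  edges zero             (suc (suc (suc zero))) ()
  edges (suc zero)       (suc zero)             ()
  edges (suc zero)       (suc (suc zero))       ()
  edges (suc (suc zero)) zero                   ()
  edges (suc (suc zero)) (suc (suc zero))       ()

-- `iterate` is applied to all rows and to the interval of length `2 ^ h` from 0, which contains the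
-- `n` actual columns.
edgeCount-bound : ∀ {n} (G : OBG n n) → Avoids G sailboat → ∀ κ h j → h ≤ j * κ → n ≤ 2 ^ h →
                  edgeCount G ≤ (suc h * 4) ^ j * (n + 2 ^ κ * 2 ^ h)
edgeCount-bound {n} G avoids κ h j h≤jκ n≤2^h = begin
  edgeCount G                                             ≡⟨ ∑-cong (λ r → sym (count-extend (G r))) ⟩
  ∑ n (λ r → count (extend (G r)) 0 n)                    ≤⟨ ∑-mono-≤ (λ r → widen (extend (G r))) ⟩
  ∑ n (λ r → count (extend (G r)) 0 (2 ^ h))              ≤⟨ iterate _ (extend-sailboatFree G avoids) κ h j ≤-refl h≤jκ (λ _ → true) 0 ⟩
  (suc h * 4) ^ j * (∑ n (λ _ → 1) + 2 ^ κ * 2 ^ h)       ≡⟨ cong (λ s → (suc h * 4) ^ j * (s + 2 ^ κ * 2 ^ h)) (∑-one n) ⟩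
  (suc h * 4) ^ j * (n + 2 ^ κ * 2 ^ h)                   ∎
  where
  open ≤-Reasoning
  widen : ∀ S → count S 0 n ≤ count S 0 (2 ^ h)
  widen S = begin
    count S 0 n                                ≤⟨ m≤m+n _ _ ⟩
    count S 0 n + count S n (2 ^ h ∸ n)        ≡⟨ sym (count-+ S 0 n (2 ^ h ∸ n)) ⟩
    count S 0 (n + (2 ^ h ∸ n))                ≡⟨ cong (count S 0) (m+[n∸m]≡n n≤2^h) ⟩
    count S 0 (2 ^ h)                          ∎

-- Logarithms and the choice of parameters.

n≤2^⌈log₂n⌉ : ∀ n → n ≤ 2 ^ ⌈log₂ n ⌉
n≤2^⌈log₂n⌉ n = go n (<-wellFounded n)
  where
  open ≤-Reasoning
  -- The logarithm recurses on an accessibility proof, so the induction follows an arbitrary one.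
  go : ∀ n (rs : Acc _<_ n) → n ≤ 2 ^ ⌈log2⌉ n rs
  go 0 _ = z≤n
  go 1 _ = ≤-refl
  go (suc (suc n)) (acc rs) = begin
    suc (suc n)                             ≡⟨ cong (λ k → suc (suc k)) (sym (⌊n/2⌋+⌈n/2⌉≡n n)) ⟩
    suc (suc (⌊ n /2⌋ + ⌈ n /2⌉))           ≤⟨ s≤s (s≤s (+-monoˡ-≤ ⌈ n /2⌉ (⌊n/2⌋≤⌈n/2⌉ n))) ⟩
    suc (suc (⌈ n /2⌉ + ⌈ n /2⌉))           ≡⟨ double ⌈ n /2⌉ ⟩
    2 * suc ⌈ n /2⌉                         ≤⟨ *-monoʳ-≤ 2 (go (suc ⌈ n /2⌉) (rs _)) ⟩
    2 * 2 ^ ⌈log2⌉ (suc ⌈ n /2⌉) (rs _)     ∎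
    where
    double : ∀ k → suc (suc (k + k)) ≡ 2 * suc k
    double = solve-∀

2^⌈log₂n⌉≤2*n : ∀ n → 1 ≤ n → 2 ^ ⌈log₂ n ⌉ ≤ 2 * n
2^⌈log₂n⌉≤2*n n 1≤n with ⌈log₂ n ⌉ in eq
... | zero  = ≤-trans 1≤n (m≤m+n n _)
... | suc h = *-monoʳ-≤ 2 (<⇒≤ (≰⇒> n≰2^h))
  where
  n≰2^h : ¬ (n ≤ 2 ^ h)
  n≰2^h n≤2^h = 1+n≰n (subst₂ _≤_ eq (⌈log₂2^n⌉≡n h) (⌈log₂⌉-mono-≤ n≤2^h))

⌈log₂n⌉≤n : ∀ n → ⌈log₂ n ⌉ ≤ n
⌈log₂n⌉≤n n = subst (⌈log₂ n ⌉ ≤_) (⌈log₂2^n⌉≡n n) (⌈log₂⌉-mono-≤ (n≤2^n n))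
  where
  n≤2^n : ∀ n → n ≤ 2 ^ n
  n≤2^n zero    = z≤n
  n≤2^n (suc n) = +-mono-≤ {1} (m^n>0 2 n) (≤-trans (n≤2^n n) (m≤m+n _ 0))

m*m≤n*n⇒m≤n : ∀ {m n} → m * m ≤ n * n → m ≤ n
m*m≤n*n⇒m≤n m²≤n² = ≮⇒≥ λ n<m → <⇒≱ (*-mono-< n<m n<m) m²≤n²

-- Take `κ = s / 4` and `j = h / κ + 1`. Since `s ≤ 5 * κ`, the constant 20 = 5 · 4 yields
-- `16 * (h * ℓ) ≤ κ * κ`, so the cost of `ℓ` per round over about `h / κ` rounds is of order `κ`.
parameters : ∀ h ℓ s → 1 ≤ ℓ → ℓ ≤ h → 20 * 20 * (h * ℓ) ≤ s * s →
             ∃[ κ ] ∃[ j ] (h ≤ j * κ × (3 + ℓ) * j + (2 + κ) ≤ s)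
parameters h ℓ s 1≤ℓ ℓ≤h s-large = κ , suc t , h≤ , total
  where
  open ≤-Reasoning
  κ = s / 4

  square : ∀ a b → a * b * (a * b) ≡ a * a * (b * b)
  square = solve-∀

  20ℓ≤s : 20 * ℓ ≤ s
  20ℓ≤s = m*m≤n*n⇒m≤n (begin
    20 * ℓ * (20 * ℓ)     ≡⟨ square 20 ℓ ⟩
    20 * 20 * (ℓ * ℓ)     ≤⟨ *-monoʳ-≤ (20 * 20) (*-monoˡ-≤ ℓ ℓ≤h) ⟩
    20 * 20 * (h * ℓ)     ≤⟨ s-large ⟩
    s * s                 ∎)

  -- This makes the remainder of `s` modulo 4 smaller than `κ`, whence `s ≤ 5 * κ`.
  5≤κ : 5 ≤ κ
  5≤κ = /-monoˡ-≤ 4 (≤-trans (*-monoʳ-≤ 20 1≤ℓ) 20ℓ≤s)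

  s≤5κ : s ≤ 5 * κ
  s≤5κ = begin
    s                   ≡⟨ m≡m%n+[m/n]*n s 4 ⟩
    s % 4 + κ * 4       ≤⟨ +-mono-≤ (≤-trans (<⇒≤ (m%n<n s 4)) (≤-trans (n≤1+n 4) 5≤κ)) (≤-reflexive (*-comm κ 4)) ⟩
    κ + 4 * κ           ∎

  4ℓ≤κ : 4 * ℓ ≤ κ
  4ℓ≤κ = *-cancelˡ-≤ 5 (≤-trans (≤-reflexive (sym (*-assoc 5 4 ℓ))) (≤-trans 20ℓ≤s s≤5κ))

  4ℓh≤κ² : 4 * ℓ * h ≤ κ * κ
  4ℓh≤κ² = begin
    4 * ℓ * h               ≡⟨ trans (*-assoc 4 ℓ h) (cong (4 *_) (*-comm ℓ h)) ⟩
    4 * (h * ℓ)             ≤⟨ *-monoˡ-≤ (h * ℓ) (m≤m*n 4 4) ⟩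
    16 * (h * ℓ)            ≤⟨ *-cancelˡ-≤ 25 25*16hℓ≤ ⟩
    κ * κ                   ∎
    where
    25*16hℓ≤ : 25 * (16 * (h * ℓ)) ≤ 25 * (κ * κ)
    25*16hℓ≤ = begin
      25 * (16 * (h * ℓ))     ≡⟨ sym (*-assoc 25 16 (h * ℓ)) ⟩
      20 * 20 * (h * ℓ)       ≤⟨ s-large ⟩
      s * s                   ≤⟨ *-mono-≤ s≤5κ s≤5κ ⟩
      5 * κ * (5 * κ)         ≡⟨ square 5 κ ⟩
      25 * (κ * κ)            ∎

  instance
    κ≢0 : NonZero κ
    κ≢0 = >-nonZero (≤-trans (s≤s z≤n) 5≤κ)

  t = h / κ

  h≤ : h ≤ suc t * κ
  h≤ = begin
    h                   ≡⟨ m≡m%n+[m/n]*n h κ ⟩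
    h % κ + t * κ       ≤⟨ +-monoˡ-≤ (t * κ) (<⇒≤ (m%n<n h κ)) ⟩
    κ + t * κ           ∎

  4ℓt≤κ : 4 * ℓ * t ≤ κ
  4ℓt≤κ = *-cancelʳ-≤ (4 * ℓ * t) κ κ (begin
    4 * ℓ * t * κ       ≡⟨ *-assoc (4 * ℓ) t κ ⟩
    4 * ℓ * (t * κ)     ≤⟨ *-monoʳ-≤ (4 * ℓ) (m/n*n≤m h κ) ⟩
    4 * ℓ * h           ≤⟨ 4ℓh≤κ² ⟩
    κ * κ               ∎)

  3+ℓ≤4ℓ : 3 + ℓ ≤ 4 * ℓ
  3+ℓ≤4ℓ = begin
    3 + ℓ               ≤⟨ +-monoˡ-≤ ℓ (*-monoʳ-≤ 3 1≤ℓ) ⟩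
    3 * ℓ + ℓ           ≡⟨ +-comm (3 * ℓ) ℓ ⟩
    4 * ℓ               ∎

  total : (3 + ℓ) * suc t + (2 + κ) ≤ s
  total = begin
    (3 + ℓ) * suc t + (2 + κ)         ≤⟨ +-monoˡ-≤ (2 + κ) (*-monoˡ-≤ (suc t) 3+ℓ≤4ℓ) ⟩
    4 * ℓ * suc t + (2 + κ)           ≡⟨ cong (_+ (2 + κ)) (*-suc (4 * ℓ) t) ⟩
    -- Each of the four summands is at most `κ`, a quarter of `s`.
    4 * ℓ + 4 * ℓ * t + (2 + κ)       ≤⟨ +-mono-≤ (+-mono-≤ 4ℓ≤κ 4ℓt≤κ) (+-monoˡ-≤ κ (≤-trans (s≤s (s≤s z≤n)) 5≤κ)) ⟩
    κ + κ + (κ + κ)                   ≡⟨ four κ ⟩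
    κ * 4                             ≤⟨ m/n*n≤m s 4 ⟩
    s                                 ∎
    where
    four : ∀ κ → κ + κ + (κ + κ) ≡ κ * 4
    four = solve-∀

-- The exponent collects `3 + ℓ` per round, from `4 * (h + 1) ≤ 8 * h` and `h ≤ 2 ^ ℓ`, and `2 + κ`
-- from the additive term, where `2 ^ h ≤ 2 * n`.
edgeCount≤n*2^s : ∀ {n s} → 3 ≤ n → (G : OBG n n) → Avoids G sailboat →
  ∀ κ j → L n ≤ j * κ → (3 + LL n) * j + (2 + κ) ≤ s → edgeCount G ≤ n * 2 ^ s
edgeCount≤n*2^s {n} {s} 3≤n G avoids κ j h≤jκ exponent≤s = begin
  edgeCount G                                   ≤⟨ edgeCount-bound G avoids κ h j h≤jκ (n≤2^⌈log₂n⌉ n) ⟩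
  (suc h * 4) ^ j * (n + 2 ^ κ * 2 ^ h)         ≤⟨ *-mono-≤ (^-monoˡ-≤ j base≤) size≤ ⟩
  (2 ^ (3 + ℓ)) ^ j * (n * 2 ^ (2 + κ))         ≡⟨ cong (_* (n * 2 ^ (2 + κ))) (^-*-assoc 2 (3 + ℓ) j) ⟩
  2 ^ ((3 + ℓ) * j) * (n * 2 ^ (2 + κ))         ≡⟨ swap (2 ^ ((3 + ℓ) * j)) n (2 ^ (2 + κ)) ⟩
  n * (2 ^ ((3 + ℓ) * j) * 2 ^ (2 + κ))         ≡⟨ cong (n *_) (sym (^-distribˡ-+-* 2 ((3 + ℓ) * j) (2 + κ))) ⟩
  n * 2 ^ ((3 + ℓ) * j + (2 + κ))               ≤⟨ *-monoʳ-≤ n (^-monoʳ-≤ 2 exponent≤s) ⟩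
  n * 2 ^ s                                     ∎
  where
  open ≤-Reasoning
  h = L n
  ℓ = LL n
  swap : ∀ a b c → a * (b * c) ≡ b * (a * c)
  swap = solve-∀
  2≤h : 2 ≤ h
  2≤h = ⌈log₂⌉-mono-≤ 3≤n
  base≤ : suc h * 4 ≤ 2 ^ (3 + ℓ)
  base≤ = begin
    suc h * 4             ≤⟨ *-monoˡ-≤ 4 (+-monoˡ-≤ h (≤-trans (s≤s z≤n) 2≤h)) ⟩
    (h + h) * 4           ≡⟨ eight h ⟩
    2 * (2 * (2 * h))     ≤⟨ *-monoʳ-≤ 2 (*-monoʳ-≤ 2 (*-monoʳ-≤ 2 (n≤2^⌈log₂n⌉ h))) ⟩
    2 ^ (3 + ℓ)           ∎
    where
    eight : ∀ h → (h + h) * 4 ≡ 2 * (2 * (2 * h))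
    eight = solve-∀
  size≤ : n + 2 ^ κ * 2 ^ h ≤ n * 2 ^ (2 + κ)
  size≤ = begin
    n + 2 ^ κ * 2 ^ h               ≤⟨ +-mono-≤ (m≤m*n n (2 ^ suc κ) ⦃ m^n≢0 2 (suc κ) ⦄) (*-monoʳ-≤ (2 ^ κ) (2^⌈log₂n⌉≤2*n n (≤-trans (s≤s z≤n) 3≤n))) ⟩
    n * 2 ^ suc κ + 2 ^ κ * (2 * n) ≡⟨ combine n (2 ^ κ) ⟩
    n * 2 ^ (2 + κ)                 ∎
    where
    combine : ∀ n p → n * (2 * p) + p * (2 * n) ≡ n * (2 * (2 * p))
    combine = solve-∀

theorem4p1 : Σ ℕ λ C → Σ ℕ λ N → ∀ (n : ℕ) → N ≤ n →
    ∀ (s : ℕ) → C * C * (L n * LL n) ≤ s * s →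
    ExAtMost sailboat n (n * 2 ^ s)
-- Any integer `s` of size at least 20 √(`L n * LL n`) is admissible, which expresses the O of the
-- exponent without roots. From `3 ≤ n` come `2 ≤ L n` and `1 ≤ LL n`.
theorem4p1 = 20 , 3 , λ n 3≤n s s-large G avoids →
  let 2≤h = ⌈log₂⌉-mono-≤ 3≤n
      κ , j , h≤jκ , exponent≤s = parameters (L n) (LL n) s (⌈log₂⌉-mono-≤ 2≤h) (⌈log₂n⌉≤n (L n)) s-large
  in edgeCount≤n*2^s 3≤n G avoids κ j h≤jκ exponent≤s
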